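{- Let $R$ be a TRS over $sign(R)$, and let $\Sigma=\{f,\sharp\}\cup sign(R)$, where $f\in\Sigma_2-sign(R)$ and $\sharp\in\Sigma_0-sign(R)$. Then $R$ is an EP$\Sigma$RF-TRS if and only if $R$ is an EPRF-TRS.
   Context: A ranked alphabet $\Sigma$ is a finite set of symbols with ranks, $\Sigma_m$ the symbols of rank $m$; $X$ a countable set of variables, $T_\Sigma(X)$ the terms, $T_\Sigma$ the ground terms. A TRS $R$ is a finite set of rules $l\to r$ of terms with every variable of $r$ occurring in $l$; $sign(R)$ is the ranked alphabet of symbols in its rules. $R^*_\Gamma(L)=\{p\mid q\Rightarrow^*_R p,\ q\in L\}$ for $L\subseteq T_\Gamma$. A bottom-up tree automaton (bta) over $\Gamma$ is a finite automaton with states (treated as constants), final states, rules $\delta(a_1,\dots,a_n)\to a$ and $a\to a'$, recognizing the ground terms rewriting to a final state. $R$ is an EP$\Gamma$RF-TRS if for any given finite $L\subseteq T_\Gamma$ one can effectively construct a bta $\mathcal{C}$ over $\Gamma$ with $L(\mathcal{C})=R^*_\Gamma(L)$. $R$ is an EPRF-TRS if for any given ranked alphabet $\Gamma\supseteq sign(R)$ and finite $L\subseteq T_\Gamma$ one can effectively construct a bta $\mathcal{C}$ over $\Gamma$ with $L(\mathcal{C})=R^*_\Gamma(L)$. -}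

module Defs where

open import Data.Nat using (ℕ)
open import Data.Fin using (Fin)
open import Data.Product using (Σ; _×_; _,_; proj₁; proj₂; ∃)
open import Data.Sum using (_⊎_)
open import Data.List using (List; []; _∷_; _++_)
open import Data.List.Membership.Propositional using (_∈_; _∉_)
import Data.List.Relation.Unary.All as LAll
open import Data.Vec using (Vec; []; _∷_; lookup; _[_]≔_)
import Data.Vec.Relation.Unary.All as VAll
open import Data.Vec.Relation.Binary.Pointwise.Inductive using (Pointwise)
open import Relation.Binary.Construct.Closure.ReflexiveTransitive using (Star)
open import Function.Bundles using (_⇔_)

Sym : Set
Sym = ℕ × ℕ

rank : Sym → ℕ
rank = proj₂

RankedAlphabet : Set
RankedAlphabet = List Sym

_⊆ₐ_ : RankedAlphabet → RankedAlphabet → Set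
Γ ⊆ₐ Δ = ∀ {s} → s ∈ Γ → s ∈ Δ

data Term : Set where
  var : ℕ → Term
  app : (s : Sym) → Vec Term (rank s) → Term

mutual
  _⟨_⟩ : Term → (ℕ → Term) → Term
  var x ⟨ σ ⟩ = σ x
  app s ts ⟨ σ ⟩ = app s (substs ts σ)

  substs : ∀ {n} → Vec Term n → (ℕ → Term) → Vec Term n
  substs [] σ = []
  substs (t ∷ ts) σ = (t ⟨ σ ⟩) ∷ substs ts σ

mutual
  vars : Term → List ℕ
  vars (var x) = x ∷ []
  vars (app s ts) = varss ts

  varss : ∀ {n} → Vec Term n → List ℕ
  varss [] = []
  varss (t ∷ ts) = vars t ++ varss ts

mutual
  syms : Term → List Sym
  syms (var x) = []
  syms (app s ts) = s ∷ symss ts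

  symss : ∀ {n} → Vec Term n → List Sym
  symss [] = []
  symss (t ∷ ts) = syms t ++ symss ts

data Ground (Γ : RankedAlphabet) : Term → Set where
  app : ∀ {s ts} → s ∈ Γ → VAll.All (Ground Γ) ts → Ground Γ (app s ts)

record Rule : Set where
  constructor _⇒_
  field
    lhs : Term
    rhs : Term

record TRS : Set where
  field
    rules   : List Rule
    varCond : LAll.All (λ ρ → ∀ x → x ∈ vars (Rule.rhs ρ) → x ∈ vars (Rule.lhs ρ)) rules
open TRS public

signRules : List Rule → RankedAlphabet
signRules [] = []
signRules ((l ⇒ r) ∷ ρs) = syms l ++ syms r ++ signRules ρs

sign : TRS → RankedAlphabet
sign R = signRules (rules R)

data Step (R : TRS) : Term → Term → Set where
  root : ∀ {l r} → (l ⇒ r) ∈ rules R → (σ : ℕ → Term) →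
         Step R (l ⟨ σ ⟩) (r ⟨ σ ⟩)
  cong : ∀ {s} (ts : Vec Term (rank s)) (i : Fin (rank s)) {u} →
         Step R (lookup ts i) u → Step R (app s ts) (app s (ts [ i ]≔ u))

Steps : TRS → Term → Term → Set
Steps R = Star (Step R)

RStar : TRS → RankedAlphabet → List Term → Term → Set
RStar R Γ L p = Ground Γ p × Σ Term (λ q → q ∈ L × Steps R q p)

record BTA (Γ : RankedAlphabet) : Set where
  field
    nStates   : ℕ
    final     : List (Fin nStates)
    δrules    : List (Σ Sym (λ s → Vec (Fin nStates) (rank s) × Fin nStates))
    δrulesOver : LAll.All (λ ρ → proj₁ ρ ∈ Γ) δrules
    εrules    : List (Fin nStates × Fin nStates)
open BTA public

data Run {Γ : RankedAlphabet} (C : BTA Γ) : Term → Fin (nStates C) → Set where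
  δstep : ∀ {s ts qs q} → (s , qs , q) ∈ δrules C →
          Pointwise (Run C) ts qs → Run C (app s ts) q
  εstep : ∀ {t q q'} → Run C t q → (q , q') ∈ εrules C → Run C t q'

Lang : {Γ : RankedAlphabet} → BTA Γ → Term → Set
Lang {Γ} C t = Ground Γ t × Σ (Fin (nStates C)) (λ q → q ∈ final C × Run C t q)

-- EPΓRF and EPRF.  "Effectively construct" is rendered by an Agda
-- function (Agda functions are computable).

EPΓRF : TRS → RankedAlphabet → Set
EPΓRF R Γ =
  (L : List Term) → LAll.All (Ground Γ) L →
  Σ (BTA Γ) (λ C → ∀ t → Lang C t ⇔ RStar R Γ L t)

EPRF : TRS → Set
EPRF R = (Γ : RankedAlphabet) → sign R ⊆ₐ Γ → EPΓRF R Γ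

{-# OPTIONS --safe #-}

-- A symbol g of Γ outside sign R, of rank n, is encoded by the comb
--   g(t₁,…,tₙ)  ↦  f(tₙ, … f(t₁, f(♯, … f(♯, ♯)))),
-- where the number of padding ♯'s depends on g in such a way that the length
-- of the right spine determines g.  Decoding walks down the right spine and
-- collects the decoded left arguments; at a symbol of sign R met on the way it
-- distributes the collected arguments over all the children, and at ♯ it reads
-- off a symbol from their number.  Hence decoding commutes with the symbols of
-- R even when a rule with a variable as left-hand side has been applied in the
-- middle of a comb, so it maps reductions to reductions, as encoding does.
-- Therefore R*_Γ(L) is the inverse image of R*_Σ(enc L) under the linear tree
-- homomorphism enc, and inverse images of this kind are recognizable.

module Submission where

open import Defs
open import Data.Bool using (true; false; if_then_else_)
open import Data.Fin using (Fin; zero; suc)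
import Data.Fin.Properties as Fin
open import Data.List using (List; []; _∷_; _++_; length; drop; replicate)
import Data.List as List
open import Data.List.Properties using (length-++; length-replicate; ++-identityʳ)
open import Data.List.Membership.Propositional using (_∈_; _∉_)
import Data.List.Membership.DecPropositional as DecMembership
open import Data.List.Membership.Propositional.Properties
import Data.List.Relation.Unary.All as LAll
import Data.List.Relation.Unary.All.Properties as LAll
import Data.List.Relation.Unary.Any as LAny
open LAny using (here; there)
open import Data.List.Relation.Binary.Pointwise as LPw using ([]; _∷_)
open import Data.List.Relation.Binary.Pointwise.Properties using (Pointwise-length)
open import Data.Nat using (ℕ; zero; suc; _+_; _≤_; _≰_; _≤?_)
open import Data.Nat.Properties using (≤-reflexive; <⇒≱; m≤m+n)
import Data.Nat.Properties as ℕ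
open import Data.Product using (Σ; ∃; ∃₂; _×_; _,_; proj₁; proj₂)
import Data.Product.Properties as Product
open import Data.Sum using (_⊎_; inj₁; inj₂)
open import Data.Vec using (Vec; []; _∷_; lookup; _[_]≔_; toList)
import Data.Vec as Vec
import Data.Vec.Properties as Vec
import Data.Vec.Relation.Unary.All as VAll
open VAll using ([]; _∷_)
open import Data.Vec.Relation.Binary.Pointwise.Inductive as VPw using (Pointwise; []; _∷_)
open import Function using (_∘_; _on_; _$_)
open import Function.Bundles using (_⇔_; mk⇔; Equivalence)
open import Level using (0ℓ)
open import Relation.Binary using (Rel; DecidableEquality; Decidable; Reflexive)
open import Relation.Binary.Construct.Closure.ReflexiveTransitive as Star using (Star; ε; _◅_; _◅◅_)
open import Relation.Binary.PropositionalEquality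
  using (_≡_; _≢_; refl; sym; trans; cong₂; subst; subst₂) renaming (cong to ≡-cong)
open import Relation.Nullary using (¬_; Dec; yes; no; does; contradiction)
open import Relation.Nullary.Decidable using (map′; _×-dec_; _⊎-dec_; dec-true; dec-false)

_≟ₛ_ : DecidableEquality Sym
_≟ₛ_ = Product.≡-dec ℕ._≟_ ℕ._≟_

open DecMembership _≟ₛ_ using (_∈?_)

-- Folds over terms, and closure of reduction under contexts.

module _ {A : Set} (φ-var : ℕ → A) (φ : (s : Sym) → Vec A (rank s) → A) where
  mutual
    fold : Term → A
    fold (var x)    = φ-var x
    fold (app s ts) = φ s (folds ts)

    folds : ∀ {n} → Vec Term n → Vec A n
    folds []       = []
    folds (t ∷ ts) = fold t ∷ folds ts

  folds-pointwise : ∀ {_∼_ : Rel A 0ℓ} {n} {ts us : Vec Term n} →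
                    Pointwise (_∼_ on fold) ts us → Pointwise _∼_ (folds ts) (folds us)
  folds-pointwise []       = []
  folds-pointwise (p ∷ ps) = p ∷ folds-pointwise ps

update-pointwise : ∀ {A : Set} {_∼_ : Rel A 0ℓ} → Reflexive _∼_ →
                   ∀ {n} (xs : Vec A n) i {y} → lookup xs i ∼ y → Pointwise _∼_ xs (xs [ i ]≔ y)
update-pointwise rfl (x ∷ xs) zero    p = p ∷ VPw.refl rfl
update-pointwise rfl (x ∷ xs) (suc i) p = rfl ∷ update-pointwise rfl xs i p

module _ (R : TRS) where

  -- Arguments are reduced from left to right; keeping the context `F` abstract lets each finished
  -- argument be absorbed into it.
  Steps-args : ∀ {n} (F : Vec Term n → Term) →
               (∀ ts i {u} → Step R (lookup ts i) u → Step R (F ts) (F (ts [ i ]≔ u))) →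
               ∀ {ts us} → Pointwise (Steps R) ts us → Steps R (F ts) (F us)
  Steps-args F F-step [] = ε
  Steps-args F F-step {_ ∷ ts} (p ∷ ps) =
    Star.gmap (λ t → F (t ∷ ts)) (F-step (_ ∷ ts) zero) p ◅◅
    Steps-args (λ us → F (_ ∷ us)) (λ us i → F-step (_ ∷ us) (suc i)) ps

  Steps-app : ∀ {s ts us} → Pointwise (Steps R) ts us → Steps R (app s ts) (app s us)
  Steps-app = Steps-args (app _) cong

lhs-syms : ∀ {l r} ρs → (l ⇒ r) ∈ ρs → ∀ {s} → s ∈ syms l → s ∈ signRules ρs
lhs-syms (_ ∷ ρs)       (here refl) s∈l = ∈-++⁺ˡ s∈l
lhs-syms ((l ⇒ r) ∷ ρs) (there p)   s∈l = ∈-++⁺ʳ (syms l) (∈-++⁺ʳ (syms r) (lhs-syms ρs p s∈l))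

rhs-syms : ∀ {l r} ρs → (l ⇒ r) ∈ ρs → ∀ {s} → s ∈ syms r → s ∈ signRules ρs
rhs-syms ((l ⇒ r) ∷ ρs) (here refl) s∈r = ∈-++⁺ʳ (syms l) (∈-++⁺ˡ s∈r)
rhs-syms ((l ⇒ r) ∷ ρs) (there p)   s∈r = ∈-++⁺ʳ (syms l) (∈-++⁺ʳ (syms r) (rhs-syms ρs p s∈r))

-- Reading a symbol and its arguments off a list of collected terms.

drop-replicate : ∀ {A : Set} n m {x : A} xs →
                 drop n (replicate (n + m) x ++ xs) ≡ replicate m x ++ xs
drop-replicate zero    m xs = refl
drop-replicate (suc n) m xs = drop-replicate n m xs

replicate-∷ : ∀ {A : Set} n {x : A} xs → replicate n x ++ x ∷ xs ≡ x ∷ replicate n x ++ xs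
replicate-∷ zero    xs = refl
replicate-∷ (suc n) xs = ≡-cong (_ ∷_) (replicate-∷ n xs)

replicate-too-long : ∀ {A : Set} n m {x : A} xs → length (replicate (suc n + m) x ++ xs) ≰ n
replicate-too-long n m {x} xs = <⇒≱ (subst (suc n ≤_)
  (sym (trans (length-++ (replicate (suc n + m) x)) (≡-cong (_+ length xs) (length-replicate _))))
  (ℕ.≤-trans (m≤m+n _ m) (m≤m+n _ (length xs))))

length-toList : ∀ {A : Set} {n} (xs : Vec A n) → length (toList xs) ≡ n
length-toList []       = refl
length-toList (_ ∷ xs) = ≡-cong suc (length-toList xs)

drop-pointwise : ∀ {A : Set} {_∼_ : Rel A 0ℓ} n {xs ys} →
                 LPw.Pointwise _∼_ xs ys → LPw.Pointwise _∼_ (drop n xs) (drop n ys)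
drop-pointwise zero    ps       = ps
drop-pointwise (suc n) []       = []
drop-pointwise (suc n) (_ ∷ ps) = drop-pointwise n ps

-- Lists that are too short are filled up with a junk variable, which
-- makes decoding total; it never occurs in the decoding of an encoded term.
fill : ∀ n → List Term → Vec Term n
fill zero    ts       = []
fill (suc n) []       = var 0 ∷ fill n []
fill (suc n) (t ∷ ts) = t ∷ fill n ts

fill-toList : ∀ {n} (ts : Vec Term n) → fill n (toList ts) ≡ ts
fill-toList []       = refl
fill-toList (t ∷ ts) = ≡-cong (t ∷_) (fill-toList ts)

-- The symbol of Γ at a given place is used for the spine lengths from
-- offset Γ g to offset Γ g + rank g; only the last one occurs in an encoding.
offset : RankedAlphabet → Sym → ℕ
offset []      g = 0
offset (s ∷ Γ) g with s ≟ₛ g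
... | yes _ = 0
... | no  _ = suc (rank s) + offset Γ g

readOff : RankedAlphabet → List Term → Term
-- Default for lists longer than all the ranges of `Γ`; the encoding of a ground term over `Γ` never
-- leads here.
readOff []      us = var 0
readOff (s ∷ Γ) us =
  if does (length us ≤? rank s) then app s (fill (rank s) us)
                                else readOff Γ (drop (suc (rank s)) us)

-- Each symbol `s` listed before `g` accounts for `suc (rank s)` padding entries: they make the list
-- too long for `s`, and `drop` removes exactly them. Only the number of padding entries counts, so
-- `x` is arbitrary.
readOff-offset : ∀ {g Γ} → g ∈ Γ → ∀ x (ts : Vec Term (rank g)) →
                 readOff Γ (replicate (offset Γ g) x ++ toList ts) ≡ app g ts
readOff-offset {g} {s ∷ Γ} g∈ x ts with s ≟ₛ g
... | yes refl
  rewrite dec-true (length (toList ts) ≤? rank s) (≤-reflexive (length-toList ts))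
  = ≡-cong (app s) (fill-toList ts)
readOff-offset (here refl) x ts | no s≢g = contradiction refl s≢g
readOff-offset {g} {s ∷ Γ} (there g∈) x ts | no s≢g
  rewrite dec-false (length (replicate (suc (rank s) + offset Γ g) x ++ toList ts) ≤? rank s)
                    (replicate-too-long (rank s) (offset Γ g) (toList ts))
        | drop-replicate (rank s) (offset Γ g) {x} (toList ts)
  = readOff-offset g∈ x ts

module _ (R : TRS) where

  fill-Steps : ∀ n {us vs} → LPw.Pointwise (Steps R) us vs → Pointwise (Steps R) (fill n us) (fill n vs)
  fill-Steps zero    _        = []
  fill-Steps (suc n) []       = ε ∷ fill-Steps n []
  fill-Steps (suc n) (p ∷ ps) = p ∷ fill-Steps n ps

  -- The symbol chosen depends only on the length of the list, which is the same on both sides.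
  readOff-Steps : ∀ Γ {us vs} → LPw.Pointwise (Steps R) us vs → Steps R (readOff Γ us) (readOff Γ vs)
  readOff-Steps []      ps = ε
  readOff-Steps (s ∷ Γ) {us} {vs} ps rewrite Pointwise-length ps with does (length vs ≤? rank s)
  ... | true  = Steps-app R (fill-Steps (rank s) ps)
  ... | false = readOff-Steps Γ (drop-pointwise (suc (rank s)) ps)

-- Decoding, and why it preserves reduction.

module Coding (R : TRS) (a b : ℕ) (f∉ : (a , 2) ∉ sign R) (♯∉ : (b , 0) ∉ sign R)
              (Γ : RankedAlphabet) where

  f ♯ : Sym
  f = a , 2
  ♯ = b , 0

  Σₐ : RankedAlphabet
  Σₐ = f ∷ ♯ ∷ sign R

  data View : Sym → Set where
    is-f  : View f
    is-♯  : View ♯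
    other : ∀ {s} → s ≢ f → s ≢ ♯ → View s

  view : ∀ s → View s
  view s with s ≟ₛ f | s ≟ₛ ♯
  ... | yes refl | _        = is-f
  ... | no  _    | yes refl = is-♯
  ... | no  s≢f  | no s≢♯   = other s≢f s≢♯

  -- The list holds the decoded left children met so far on the spine. With a rule x → g(x,x), the
  -- step from f(u,v) to f(u,g(v,v)) decodes to a step from d to g(d,d), because `g` hands the list
  -- containing u on to both copies of v.
  decodeView : ∀ {s} → View s → Vec (List Term → Term) (rank s) → List Term → Term
  decodeView     is-f        (u ∷ v ∷ []) as = v (u [] ∷ as)
  decodeView     is-♯        []           as = readOff Γ as
  decodeView {s} (other _ _) ds           as = app s (Vec.map (_$ as) ds)

  decodeSym : (s : Sym) → Vec (List Term → Term) (rank s) → List Term → Term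
  decodeSym s = decodeView (view s)

  decode : Term → List Term → Term
  decode = fold (λ x _ → var x) decodeSym

  decodes : ∀ {n} → Vec Term n → Vec (List Term → Term) n
  decodes = folds (λ x _ → var x) decodeSym

  decodeSym-f : ∀ u v as → decodeSym f (u ∷ v ∷ []) as ≡ v (u [] ∷ as)
  decodeSym-f u v as with view f
  ... | is-f        = refl
  ... | other f≢f _ = contradiction refl f≢f

  decodeSym-♯ : ∀ as → decodeSym ♯ [] as ≡ readOff Γ as
  decodeSym-♯ as with view ♯
  ... | is-♯        = refl
  ... | other _ ♯≢♯ = contradiction refl ♯≢♯

  decodeSym-sign : ∀ {s} → s ∈ sign R → ∀ ds as → decodeSym s ds as ≡ app s (Vec.map (_$ as) ds)
  decodeSym-sign {s} s∈ ds as with view s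
  ... | is-f      = contradiction s∈ f∉
  ... | is-♯      = contradiction s∈ ♯∉
  ... | other _ _ = refl

  mutual
    -- Symbols of `R` pass the list down unchanged, so every variable occurrence sees the same `as`.
    -- Hence a single decoded substitution serves both sides of a rule.
    decode-subst : ∀ t σ as → LAll.All (_∈ sign R) (syms t) →
                   decode (t ⟨ σ ⟩) as ≡ t ⟨ (λ x → decode (σ x) as) ⟩
    decode-subst (var x)    σ as _             = refl
    decode-subst (app s ts) σ as (s∈ LAll.∷ ∈s) =
      trans (decodeSym-sign s∈ _ as) (≡-cong (app s) (decodes-substs ts σ as ∈s))

    decodes-substs : ∀ {n} (ts : Vec Term n) σ as → LAll.All (_∈ sign R) (symss ts) →
                     Vec.map (_$ as) (decodes (substs ts σ)) ≡ substs ts (λ x → decode (σ x) as)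
    decodes-substs []       σ as _  = refl
    decodes-substs (t ∷ ts) σ as ∈s =
      cong₂ _∷_ (decode-subst t σ as (LAll.++⁻ˡ (syms t) ∈s))
                (decodes-substs ts σ as (LAll.++⁻ʳ (syms t) ∈s))

  mutual
    -- A step in the left child of `f` alters one entry of the list under which the right child is
    -- decoded. That entry may be copied or discarded further down, so one step can become several
    -- or none.
    decode-mono : ∀ t {as bs} → LPw.Pointwise (Steps R) as bs → Steps R (decode t as) (decode t bs)
    decode-mono (var x)    ps = ε
    decode-mono (app s ts) ps with view s
    decode-mono (app _ (u ∷ v ∷ [])) ps | is-f      = decode-mono v (ε ∷ ps)
    decode-mono (app _ [])           ps | is-♯      = readOff-Steps R Γ ps
    decode-mono (app s ts)           ps | other _ _ = Steps-app R (decodes-mono ts ps)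

    decodes-mono : ∀ {n} (ts : Vec Term n) {as bs} → LPw.Pointwise (Steps R) as bs →
                   Pointwise (Steps R) (Vec.map (_$ as) (decodes ts)) (Vec.map (_$ bs) (decodes ts))
    decodes-mono []       ps = []
    decodes-mono (t ∷ ts) ps = decode-mono t ps ∷ decodes-mono ts ps

  -- Quantifying over all lists is what makes the induction go through: below `f` the right child is
  -- decoded with a longer list.
  decode-Step : ∀ {t u} → Step R t u → ∀ as → Steps R (decode t as) (decode u as)
  decode-Step (root {l} {r} ρ∈ σ) as =
    subst₂ (Steps R) (sym (decode-subst l σ as (LAll.tabulate (lhs-syms (rules R) ρ∈))))
                     (sym (decode-subst r σ as (LAll.tabulate (rhs-syms (rules R) ρ∈))))
                     (root ρ∈ _ ◅ ε)
  decode-Step (cong {s} ts i st) as with view s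
  decode-Step (cong (u ∷ v ∷ []) zero       st) as | is-f = decode-mono v (decode-Step st [] ∷ LPw.refl ε)
  decode-Step (cong (u ∷ v ∷ []) (suc zero) st) as | is-f = decode-Step st _
  decode-Step (cong [] () st) as | is-♯
  decode-Step (cong ts i st) as | other _ _ =
    Steps-app R (VPw.map⁺ (λ p → p as)
      (folds-pointwise _ _ {_∼_ = λ d e → ∀ as → Steps R (d as) (e as)}
        (update-pointwise (λ _ → ε) ts i (decode-Step st))))

  decode-Steps : ∀ {t u} → Steps R t u → Steps R (decode t []) (decode u [])
  decode-Steps = Star.kleisliStar (λ t → decode t []) (λ st → decode-Step st [])

  -- Encoding, and decoding as its left inverse.

  pads : ℕ → Term
  pads zero    = app ♯ []
  pads (suc k) = app f (app ♯ [] ∷ pads k ∷ [])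

  -- The first argument lies innermost. Decoding starts at the root and pushes each left child to
  -- the front, so the original order is restored, with the padding in front of it.
  comb : ∀ {n} → Term → Vec Term n → Term
  comb v []       = v
  comb v (u ∷ us) = comb (app f (u ∷ v ∷ [])) us

  encodeSym : (s : Sym) → Vec Term (rank s) → Term
  encodeSym s us with s ∈? sign R
  ... | yes _ = app s us
  ... | no  _ = comb (pads (offset Γ s)) us

  encode : Term → Term
  encode = fold var encodeSym

  encodes : ∀ {n} → Vec Term n → Vec Term n
  encodes = folds var encodeSym

  encodeSym-sign : ∀ {s} → s ∈ sign R → ∀ us → encodeSym s us ≡ app s us
  encodeSym-sign {s} s∈ us with s ∈? sign R
  ... | yes _ = refl
  ... | no s∉ = contradiction s∈ s∉

  mutual
    encode-subst : ∀ t σ → LAll.All (_∈ sign R) (syms t) → encode (t ⟨ σ ⟩) ≡ t ⟨ encode ∘ σ ⟩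
    encode-subst (var x)    σ _              = refl
    encode-subst (app s ts) σ (s∈ LAll.∷ ∈s) =
      trans (encodeSym-sign s∈ _) (≡-cong (app s) (encodes-substs ts σ ∈s))

    encodes-substs : ∀ {n} (ts : Vec Term n) σ → LAll.All (_∈ sign R) (symss ts) →
                     encodes (substs ts σ) ≡ substs ts (encode ∘ σ)
    encodes-substs []       σ _  = refl
    encodes-substs (t ∷ ts) σ ∈s =
      cong₂ _∷_ (encode-subst t σ (LAll.++⁻ˡ (syms t) ∈s))
                (encodes-substs ts σ (LAll.++⁻ʳ (syms t) ∈s))

  comb-Steps : ∀ {n v w} {us vs : Vec Term n} → Steps R v w → Pointwise (Steps R) us vs →
               Steps R (comb v us) (comb w vs)
  comb-Steps p []       = p
  comb-Steps p (q ∷ qs) = comb-Steps (Steps-app R (q ∷ p ∷ [])) qs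

  encodeSym-Steps : ∀ s {us vs} → Pointwise (Steps R) us vs → Steps R (encodeSym s us) (encodeSym s vs)
  encodeSym-Steps s ps with s ∈? sign R
  ... | yes _ = Steps-app R ps
  ... | no  _ = comb-Steps ε ps

  encode-Step : ∀ {t u} → Step R t u → Steps R (encode t) (encode u)
  encode-Step (root {l} {r} ρ∈ σ) =
    subst₂ (Steps R) (sym (encode-subst l σ (LAll.tabulate (lhs-syms (rules R) ρ∈))))
                     (sym (encode-subst r σ (LAll.tabulate (rhs-syms (rules R) ρ∈))))
                     (root ρ∈ _ ◅ ε)
  encode-Step (cong {s} ts i st) =
    encodeSym-Steps s (folds-pointwise _ _ (update-pointwise ε ts i (encode-Step st)))

  encode-Steps : ∀ {t u} → Steps R t u → Steps R (encode t) (encode u)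
  encode-Steps = Star.kleisliStar encode encode-Step

  decode-comb : ∀ {n} (us : Vec Term n) v as →
                decode (comb v us) as ≡ decode v (toList (Vec.map (_$ []) (decodes us)) ++ as)
  decode-comb []       v as = refl
  decode-comb (u ∷ us) v as = trans (decode-comb us _ as) (decodeSym-f (decode u) (decode v) _)

  decode-pads : ∀ k as → decode (pads k) as ≡ readOff Γ (replicate k (decode (app ♯ []) []) ++ as)
  decode-pads zero    as = decodeSym-♯ as
  decode-pads (suc k) as =
    trans (decodeSym-f (decode (app ♯ [])) (decode (pads k)) as)
    (trans (decode-pads k _) (≡-cong (readOff Γ) (replicate-∷ k as)))

  mutual
    decode-encode : ∀ {t} → Ground Γ t → decode (encode t) [] ≡ t
    decode-encode {app s ts} (app s∈Γ gs) with s ∈? sign R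
    ... | yes s∈ = trans (decodeSym-sign s∈ _ []) (≡-cong (app s) (decodes-encodes gs))
    ... | no  _  =
      trans (decode-comb (encodes ts) (pads (offset Γ s)) [])
      (trans (decode-pads (offset Γ s) _)
      (trans (≡-cong (λ us → readOff Γ (replicate (offset Γ s) _ ++ us))
               (trans (++-identityʳ _) (≡-cong toList (decodes-encodes gs))))
      (readOff-offset s∈Γ _ ts)))

    decodes-encodes : ∀ {n} {ts : Vec Term n} → VAll.All (Ground Γ) ts →
                      Vec.map (_$ []) (decodes (encodes ts)) ≡ ts
    decodes-encodes []       = refl
    decodes-encodes (g ∷ gs) = cong₂ _∷_ (decode-encode g) (decodes-encodes gs)

  pads-Ground : ∀ k → Ground Σₐ (pads k)
  pads-Ground zero    = app (there (here refl)) []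
  pads-Ground (suc k) = app (here refl) (pads-Ground 0 ∷ pads-Ground k ∷ [])

  comb-Ground : ∀ {n v} {us : Vec Term n} → Ground Σₐ v → VAll.All (Ground Σₐ) us → Ground Σₐ (comb v us)
  comb-Ground g []       = g
  comb-Ground g (h ∷ hs) = comb-Ground (app (here refl) (h ∷ g ∷ [])) hs

  mutual
    encode-Ground : ∀ {t} → Ground Γ t → Ground Σₐ (encode t)
    encode-Ground {app s ts} (app _ gs) with s ∈? sign R
    ... | yes s∈ = app (there (there s∈)) (encodes-Ground gs)
    ... | no  _  = comb-Ground (pads-Ground (offset Γ s)) (encodes-Ground gs)

    encodes-Ground : ∀ {n} {ts : Vec Term n} → VAll.All (Ground Γ) ts → VAll.All (Ground Σₐ) (encodes ts)
    encodes-Ground []       = []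
    encodes-Ground (g ∷ gs) = encode-Ground g ∷ encodes-Ground gs

  -- Encoding carries reductions forward. Backwards, decoding is applied to the whole reduction,
  -- whose intermediate terms need not be encodings; only its two ends have to decode to the right
  -- terms.
  encode-RStar : ∀ {L} → LAll.All (Ground Γ) L → ∀ {t} → Ground Γ t →
                 RStar R Γ L t ⇔ RStar R Σₐ (List.map encode L) (encode t)
  encode-RStar {L} gL {t} gt = mk⇔ to from
    where
    to : RStar R Γ L t → RStar R Σₐ (List.map encode L) (encode t)
    to (_ , q , q∈ , st) = encode-Ground gt , encode q , ∈-map⁺ encode q∈ , encode-Steps st

    from : RStar R Σₐ (List.map encode L) (encode t) → RStar R Γ L t
    from (_ , q′ , q′∈ , st) with ∈-map⁻ encode q′∈
    ... | q , q∈ , refl =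
      gt , q , q∈ , subst₂ (Steps R) (decode-encode (LAll.lookup gL q∈)) (decode-encode gt) (decode-Steps st)

-- Decidable reachability in a finite graph.

module _ {A : Set} where

  Edge : List (A × A) → Rel A 0ℓ
  Edge E x y = (x , y) ∈ E

  -- A path through the edge (x , y) may be shortened so as to use it only
  -- once: cut it before the first and after the last passage.
  Reach : List (A × A) → Rel A 0ℓ
  Reach []            i j = i ≡ j
  Reach ((x , y) ∷ E) i j = Reach E i j ⊎ (Reach E i x × Reach E y j)

  Reach-refl : ∀ E {i} → Reach E i i
  Reach-refl []      = refl
  Reach-refl (_ ∷ E) = inj₁ (Reach-refl E)

  Edge-Reach : ∀ E {i k j} → Edge E i k → Reach E k j → Reach E i j
  Edge-Reach (_ ∷ E) (here refl) (inj₁ r)       = inj₂ (Reach-refl E , r)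
  -- The path comes back to the edge just prepended; the loop in between is cut out.
  Edge-Reach (_ ∷ E) (here refl) (inj₂ (_ , r)) = inj₂ (Reach-refl E , r)
  Edge-Reach (_ ∷ E) (there e)   (inj₁ r)       = inj₁ (Edge-Reach E e r)
  Edge-Reach (_ ∷ E) (there e)   (inj₂ (r , s)) = inj₂ (Edge-Reach E e r , s)

  Star⇒Reach : ∀ E {i j} → Star (Edge E) i j → Reach E i j
  Star⇒Reach E = Star.fold (Reach E) (Edge-Reach E) (Reach-refl E)

  Reach⇒Star : ∀ E {i j} → Reach E i j → Star (Edge E) i j
  Reach⇒Star []      refl           = ε
  Reach⇒Star (_ ∷ E) (inj₁ r)       = Star.map there (Reach⇒Star E r)
  Reach⇒Star (_ ∷ E) (inj₂ (r , s)) =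
    Star.map there (Reach⇒Star E r) ◅◅ here refl ◅ Star.map there (Reach⇒Star E s)

  module _ (_≟_ : DecidableEquality A) where

    reach? : ∀ E → Decidable (Reach E)
    reach? []            i j = i ≟ j
    reach? ((x , y) ∷ E) i j = reach? E i j ⊎-dec (reach? E i x ×-dec reach? E y j)

    star? : ∀ E → Decidable (Star (Edge E))
    star? E i j = map′ (Reach⇒Star E) (Star⇒Reach E) (reach? E i j)

-- Finite search and decidability of runs of a tree automaton.

vectors : ∀ k n → List (Vec (Fin k) n)
vectors k zero    = [] ∷ []
vectors k (suc n) = List.cartesianProductWith _∷_ (List.allFin k) (vectors k n)

∈-vectors : ∀ {k n} (qs : Vec (Fin k) n) → qs ∈ vectors k n
∈-vectors []       = here refl
∈-vectors (q ∷ qs) = ∈-cartesianProductWith⁺ _∷_ (∈-allFin q) (∈-vectors qs)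

any-vec? : ∀ {k n} {P : Vec (Fin k) n → Set} → (∀ qs → Dec (P qs)) → Dec (∃ P)
any-vec? P? = map′ LAny.satisfied (λ (qs , p) → LAny.map (λ { refl → p }) (∈-vectors qs))
                   (LAny.any? P? (vectors _ _))

module Automaton {Δ : RankedAlphabet} (C : BTA Δ) where

  State : Set
  State = Fin (nStates C)

  Trans : Set
  Trans = Σ Sym (λ s → Vec State (rank s) × State)

  _≟ₜ_ : DecidableEquality Trans
  _≟ₜ_ = Product.≡-dec _≟ₛ_ (Product.≡-dec (Vec.≡-dec Fin._≟_) Fin._≟_)

  open DecMembership _≟ₜ_ using () renaming (_∈?_ to _∈ₜ?_)

  _⟶ε_ : Rel State 0ℓ
  _⟶ε_ = Star (Edge (εrules C))

  _⟶ε?_ : Decidable _⟶ε_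
  _⟶ε?_ = star? Fin._≟_ (εrules C)

  -- Absorbing the ε-moves that follow a δ-rule gives one such transition per symbol occurrence, so
  -- runs can be inverted along the structure of the term.
  Fires : (s : Sym) → Vec State (rank s) → State → Set
  Fires s qs q = ∃ λ q′ → (s , qs , q′) ∈ δrules C × q′ ⟶ε q

  fires? : ∀ s qs q → Dec (Fires s qs q)
  fires? s qs q = Fin.any? λ q′ → ((s , qs , q′) ∈ₜ? δrules C) ×-dec (q′ ⟶ε? q)

  Run-ε : ∀ {t q q′} → Run C t q → q ⟶ε q′ → Run C t q′
  Run-ε r ε        = r
  Run-ε r (e ◅ es) = Run-ε (εstep r e) es

  Run-app⁺ : ∀ {s ts qs q} → Pointwise (Run C) ts qs → Fires s qs q → Run C (app s ts) q
  Run-app⁺ rs (_ , δ∈ , es) = Run-ε (δstep δ∈ rs) es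

  Run-app⁻ : ∀ {s ts q} → Run C (app s ts) q → ∃ λ qs → Pointwise (Run C) ts qs × Fires s qs q
  Run-app⁻ (δstep δ∈ rs) = _ , rs , _ , δ∈ , ε
  Run-app⁻ (εstep r e) with Run-app⁻ r
  ... | qs , rs , q′ , δ∈ , es = qs , rs , q′ , δ∈ , es ◅◅ e ◅ ε

  Run-var : ∀ {x q} → ¬ Run C (var x) q
  Run-var (εstep r e) = Run-var r

  mutual
    -- Serves to compute the states that the padding of a symbol can reach, from which the spine of
    -- its comb is then traversed.
    run? : ∀ t q → Dec (Run C t q)
    run? (var x)    q = no Run-var
    run? (app s ts) q =
      map′ (λ (_ , rs , fs) → Run-app⁺ rs fs) Run-app⁻
           (any-vec? (λ qs → runs? ts qs ×-dec fires? s qs q))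

    runs? : ∀ {n} (ts : Vec Term n) qs → Dec (Pointwise (Run C) ts qs)
    runs? []       []       = yes []
    runs? (t ∷ ts) (q ∷ qs) = map′ (λ (r , rs) → r ∷ rs) VPw.uncons (run? t q ×-dec runs? ts qs)

-- The inverse image of a recognizable language under the encoding.

module Preimage (R : TRS) (a b : ℕ) (f∉ : (a , 2) ∉ sign R) (♯∉ : (b , 0) ∉ sign R)
                (Γ : RankedAlphabet) (C : BTA (Coding.Σₐ R a b f∉ ♯∉ Γ)) where

  open Coding R a b f∉ ♯∉ Γ
  open Automaton C

  -- The part of a run that climbs the spine of a comb, from `p` at its lower end to `q` at the
  -- root; the arguments enter only through their states.
  Walk : ∀ {n} → State → Vec State n → State → Set
  Walk p []       q = p ≡ q
  Walk p (r ∷ rs) q = ∃ λ p′ → Fires f (r ∷ p ∷ []) p′ × Walk p′ rs q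

  walk? : ∀ {n} p (rs : Vec State n) q → Dec (Walk p rs q)
  walk? p []       q = p Fin.≟ q
  walk? p (r ∷ rs) q = Fin.any? λ p′ → fires? f (r ∷ p ∷ []) p′ ×-dec walk? p′ rs q

  Run-comb⁺ : ∀ {n v p q} {us : Vec Term n} {rs : Vec State n} →
              Run C v p → Pointwise (Run C) us rs → Walk p rs q → Run C (comb v us) q
  Run-comb⁺ r []       refl          = r
  Run-comb⁺ r (s ∷ ss) (_ , fs , ws) = Run-comb⁺ (Run-app⁺ (s ∷ r ∷ []) fs) ss ws

  Run-comb⁻ : ∀ {n v q} (us : Vec Term n) → Run C (comb v us) q →
              ∃₂ λ p (rs : Vec State n) → Run C v p × Pointwise (Run C) us rs × Walk p rs q
  Run-comb⁻ []       r = _ , [] , r , [] , refl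
  Run-comb⁻ (u ∷ us) r with Run-comb⁻ us r
  ... | p′ , rs , r′ , ss , ws with Run-app⁻ r′
  ... | s ∷ p ∷ [] , s-run ∷ p-run ∷ [] , fs = p , s ∷ rs , p-run , s-run ∷ ss , p′ , fs , ws

  -- One transition simulates a run of `C` across the whole encoding of `s`. Each argument occurs
  -- there exactly once, so one state per argument suffices.
  EncFires : (s : Sym) → Vec State (rank s) → State → Set
  EncFires s qs q with s ∈? sign R
  ... | yes _ = Fires s qs q
  ... | no  _ = ∃ λ p → Run C (pads (offset Γ s)) p × Walk p qs q

  encFires? : ∀ s qs q → Dec (EncFires s qs q)
  encFires? s qs q with s ∈? sign R
  ... | yes _ = fires? s qs q
  ... | no  _ = Fin.any? λ p → run? (pads (offset Γ s)) p ×-dec walk? p qs q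

  Run-encodeSym⁺ : ∀ s {us qs q} → Pointwise (Run C) us qs → EncFires s qs q → Run C (encodeSym s us) q
  Run-encodeSym⁺ s rs fs with s ∈? sign R
  ... | yes _ = Run-app⁺ rs fs
  Run-encodeSym⁺ s rs (_ , r , ws) | no _ = Run-comb⁺ r rs ws

  Run-encodeSym⁻ : ∀ s us {q} → Run C (encodeSym s us) q →
                   ∃ λ qs → Pointwise (Run C) us qs × EncFires s qs q
  Run-encodeSym⁻ s us r with s ∈? sign R
  ... | yes _ = Run-app⁻ r
  ... | no  _ with Run-comb⁻ us r
  ... | p , qs , r′ , rs , ws = qs , rs , p , r′ , ws

  candidates : Sym → List Trans
  candidates s = List.map (s ,_) (List.cartesianProduct (vectors _ (rank s)) (List.allFin _))

  transitions : List Trans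
  transitions = List.filter (λ (s , qs , q) → encFires? s qs q) (List.concatMap candidates Γ)

  ∈-transitions⁺ : ∀ {s qs q} → s ∈ Γ → EncFires s qs q → (s , qs , q) ∈ transitions
  ∈-transitions⁺ {s} {qs} {q} s∈ fs =
    ∈-filter⁺ _ (∈-concatMap⁺ candidates (LAny.map (λ { refl →
      ∈-map⁺ (s ,_) (∈-cartesianProduct⁺ (∈-vectors qs) (∈-allFin q)) }) s∈)) fs

  ∈-transitions⁻ : ∀ {s qs q} → (s , qs , q) ∈ transitions → s ∈ Γ × EncFires s qs q
  ∈-transitions⁻ tr∈ with ∈-filter⁻ _ {xs = List.concatMap candidates Γ} tr∈
  ... | c∈ , fs = LAny.map symbol (∈-concatMap⁻ candidates c∈) , fs
    where
    symbol : ∀ {s qs q g} → (s , qs , q) ∈ candidates g → s ≡ g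
    symbol {g = g} p with ∈-map⁻ (g ,_) p
    ... | _ , _ , refl = refl

  preimage : BTA Γ
  preimage = record
    { nStates    = nStates C
    ; final      = final C
    ; δrules     = transitions
    ; δrulesOver = LAll.tabulate (proj₁ ∘ ∈-transitions⁻)
    -- The ε-moves of `C` are already contained in `Fires`.
    ; εrules     = []
    }

  mutual
    Run-preimage⁻ : ∀ {t q} → Run preimage t q → Run C (encode t) q
    Run-preimage⁻ (δstep {s} δ∈ rs) = Run-encodeSym⁺ s (Runs-preimage⁻ rs) (proj₂ (∈-transitions⁻ δ∈))

    Runs-preimage⁻ : ∀ {n} {ts : Vec Term n} {qs} →
                     Pointwise (Run preimage) ts qs → Pointwise (Run C) (encodes ts) qs
    Runs-preimage⁻ []       = []
    Runs-preimage⁻ (r ∷ rs) = Run-preimage⁻ r ∷ Runs-preimage⁻ rs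

  mutual
    Run-preimage⁺ : ∀ {t q} → Ground Γ t → Run C (encode t) q → Run preimage t q
    Run-preimage⁺ {app s ts} (app s∈ gs) r with Run-encodeSym⁻ s (encodes ts) r
    ... | qs , rs , fs = δstep (∈-transitions⁺ s∈ fs) (Runs-preimage⁺ gs rs)

    Runs-preimage⁺ : ∀ {n} {ts : Vec Term n} {qs} → VAll.All (Ground Γ) ts →
                     Pointwise (Run C) (encodes ts) qs → Pointwise (Run preimage) ts qs
    Runs-preimage⁺ []       []       = []
    Runs-preimage⁺ (g ∷ gs) (r ∷ rs) = Run-preimage⁺ g r ∷ Runs-preimage⁺ gs rs

  Lang-preimage : ∀ {t} → Ground Γ t → Lang preimage t ⇔ Lang C (encode t)
  Lang-preimage g = mk⇔
    (λ (_ , q , q∈ , r) → encode-Ground g , q , q∈ , Run-preimage⁻ r)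
    (λ (_ , q , q∈ , r) → g , q , q∈ , Run-preimage⁺ g r)

-- Transfer from the alphabet with `f` and `♯` to an arbitrary one.

EPΓRF-extend : ∀ R {a b} → (a , 2) ∉ sign R → (b , 0) ∉ sign R →
               EPΓRF R ((a , 2) ∷ (b , 0) ∷ sign R) → ∀ Γ → EPΓRF R Γ
EPΓRF-extend R {a} {b} f∉ ♯∉ ep Γ L gL = preimage , λ t → mk⇔
  (λ t∈ → let open Equivalence in
     from (encode-RStar gL (proj₁ t∈)) (to (C-lang (encode t)) (to (Lang-preimage (proj₁ t∈)) t∈)))
  (λ t∈ → let open Equivalence in
     from (Lang-preimage (proj₁ t∈)) (from (C-lang (encode t)) (to (encode-RStar gL (proj₁ t∈)) t∈)))
  where
  open Coding R a b f∉ ♯∉ Γ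
  encodedL = ep (List.map encode L) (LAll.map⁺ (LAll.map encode-Ground gL))
  C = proj₁ encodedL
  C-lang = proj₂ encodedL
  open Preimage R a b f∉ ♯∉ Γ C

mainTheorem17 : (R : TRS) (f ♯ : Sym) →
    rank f ≡ 2 → rank ♯ ≡ 0 → f ∉ sign R → ♯ ∉ sign R →
    EPΓRF R (f ∷ ♯ ∷ sign R) ⇔ EPRF R
mainTheorem17 R (a , _) (b , _) refl refl f∉ ♯∉ = mk⇔
  (λ ep Γ _ → EPΓRF-extend R f∉ ♯∉ ep Γ)
  (λ ep → ep _ λ {_} s∈ → there (there s∈))
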